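{- Let $T$ be a theory with finite relational signature. Then $T$ has a computable sampling if and only if $\mathrm{CSP}(T)$ is decidable.
   Context: For a finite relational signature $\tau$, an atomic $\tau$-formula is of the form $R(x_1,\dots,x_k)$ with $R\in\tau$ of arity $k$, or $x_1=x_2$, or $\bot$. $\mathrm{CSP}(T)$ is the computational problem of deciding, given a finite conjunction of atomic $\tau$-formulas, whether it is satisfiable in some model of $T$. A sampling for $T$ is a sequence $(L_n)_{n\in\mathbb{N}}$ of finite sets of finite $\tau$-structures such that for all $n$ and every conjunction $\phi$ of atomic $\tau$-formulas with at most $n$ variables, $\phi$ is satisfiable in some model of $T$ iff $\phi$ is satisfiable in some $\mathfrak{B}\in L_n$. A sampling is computable if there is an algorithm that, given $n$, computes $L_n$. -}

module Defs where

open import Data.Nat using (ℕ; suc)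
open import Data.Fin using (Fin; zero; suc)
open import Data.Vec using (Vec; map)
open import Data.List using (List)
open import Data.List.Relation.Unary.All using (All)
open import Data.List.Membership.Propositional using (_∈_)
open import Data.Product using (Σ; Σ-syntax; ∃; _×_)
open import Data.Sum using (_⊎_)
open import Data.Empty using (⊥)
open import Data.Bool using (Bool; T)
open import Relation.Binary.PropositionalEquality using (_≡_)
open import Relation.Nullary using (¬_; Dec)
open import Function.Bundles using (_⇔_)

record Signature : Set where
  field
    nRel  : ℕ
    arity : Fin nRel → ℕ

module _ (τ : Signature) where
  open Signature τ

  -- A τ-structure (domain nonempty, as usual in first-order logic).
  record Structure : Set₁ where
    field
      Carrier : Set
      point   : Carrier
      rel     : (R : Fin nRel) → Vec Carrier (arity R) → Set

  data Formula (n : ℕ) : Set where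
    rel     : (R : Fin nRel) → Vec (Fin n) (arity R) → Formula n
    eq      : Fin n → Fin n → Formula n
    falsum  : Formula n
    neg     : Formula n → Formula n
    and     : Formula n → Formula n → Formula n
    or      : Formula n → Formula n → Formula n
    imp     : Formula n → Formula n → Formula n
    all     : Formula (suc n) → Formula n
    ex      : Formula (suc n) → Formula n

  Sentence : Set
  Sentence = Formula 0

  Theory : Set₁
  Theory = Sentence → Set

  extend : {A : Set} {n : ℕ} → A → (Fin n → A) → Fin (suc n) → A
  extend a ρ zero    = a
  extend a ρ (suc i) = ρ i

  Sat : (M : Structure) {n : ℕ} → Formula n → (Fin n → Structure.Carrier M) → Set
  Sat M (rel R xs) ρ = Structure.rel M R (map ρ xs)
  Sat M (eq i j)   ρ = ρ i ≡ ρ j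
  Sat M falsum     ρ = ⊥
  Sat M (neg φ)    ρ = ¬ Sat M φ ρ
  Sat M (and φ ψ)  ρ = Sat M φ ρ × Sat M ψ ρ
  Sat M (or φ ψ)   ρ = Sat M φ ρ ⊎ Sat M ψ ρ
  Sat M (imp φ ψ)  ρ = Sat M φ ρ → Sat M ψ ρ
  Sat M (all φ)    ρ = (a : Structure.Carrier M) → Sat M φ (extend a ρ)
  Sat M (ex φ)     ρ = Σ[ a ∈ Structure.Carrier M ] Sat M φ (extend a ρ)

  noVars : {A : Set} → Fin 0 → A
  noVars ()

  IsModel : Theory → Structure → Set
  IsModel Th M = (σ : Sentence) → Th σ → Sat M σ noVars

  data Atom (n : ℕ) : Set where
    relA : (R : Fin nRel) → Vec (Fin n) (arity R) → Atom n
    eqA  : Fin n → Fin n → Atom n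
    botA : Atom n

  Conj : ℕ → Set
  Conj n = List (Atom n)

  SatAtom : (M : Structure) {n : ℕ} → (Fin n → Structure.Carrier M) → Atom n → Set
  SatAtom M ρ (relA R xs) = Structure.rel M R (map ρ xs)
  SatAtom M ρ (eqA i j)   = ρ i ≡ ρ j
  SatAtom M ρ botA        = ⊥

  SatisfiableIn : Structure → {n : ℕ} → Conj n → Set
  SatisfiableIn M {n} φ = Σ[ ρ ∈ (Fin n → Structure.Carrier M) ] All (SatAtom M ρ) φ

  SatisfiableInTheory : Theory → {n : ℕ} → Conj n → Set₁
  SatisfiableInTheory Th φ = Σ[ M ∈ Structure ] (IsModel Th M × SatisfiableIn M φ)

  record FinStructure : Set where
    field
      size : ℕ
      frel : (R : Fin nRel) → Vec (Fin (suc size)) (arity R) → Bool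

  toStructure : FinStructure → Structure
  toStructure B = record
    { Carrier = Fin (suc (FinStructure.size B))
    ; point   = zero
    ; rel     = λ R xs → T (FinStructure.frel B R xs)
    }

  IsSampling : Theory → (ℕ → List FinStructure) → Set₁
  IsSampling Th L = (n : ℕ) (φ : Conj n) →
    SatisfiableInTheory Th φ ⇔ (∃ λ B → B ∈ L n × SatisfiableIn (toStructure B) φ)

  -- A computable sampling: an (Agda-definable, hence computable) function n ↦ L n.
  HasComputableSampling : Theory → Set₁
  HasComputableSampling Th = Σ[ L ∈ (ℕ → List FinStructure) ] IsSampling Th L

  -- CSP(Th) is decidable: an (Agda-definable) decision procedure for all instances.
  CSPDecidable : Theory → Set₁
  CSPDecidable Th = (n : ℕ) (φ : Conj n) → Dec (SatisfiableInTheory Th φ)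

-- A sampling decides CSP(T) by exhaustive search: φ is satisfiable in T iff
-- it is satisfiable in one of the finitely many finite structures in L n.
--
-- Conversely, a decision procedure for CSP(T) saturates a satisfiable φ to a
-- complete atomic type: run through all atoms over the variables, adding each
-- one that keeps the conjunction satisfiable. The model realising the final
-- conjunction satisfies no atom that was rejected, so the atoms true at its
-- assignment are exactly the accepted ones. Hence L n may consist of the
-- structures on n + 1 points whose positive diagram is satisfiable in T; the
-- structure read off a complete type (identifying variables along its
-- equalities) is one of them, and it satisfies φ. The extra point is a spare
-- variable sent to an arbitrary element, making the structures nonempty.

module Submission where

open import Defs
open import Data.Bool using (Bool; true; false; T; if_then_else_)
open import Data.Bool.Properties using (T?)
open import Data.Empty using (⊥-elim)
open import Data.Fin using (Fin; zero; suc; _≟_)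
open import Data.List
  using (List; []; _∷_; [_]; _++_; length; map; filter; concatMap; cartesianProductWith; allFin; lookup)
open import Data.List.Membership.Propositional using (_∈_; find; lose)
open import Data.List.Membership.Propositional.Properties
  using (∈-++⁺ˡ; ∈-++⁺ʳ; ∈-map⁺; ∈-map⁻; ∈-concatMap⁺; ∈-cartesianProductWith⁺; ∈-filter⁺; ∈-filter⁻; ∈-allFin)
open import Data.List.Relation.Unary.All as All using (All; _∷_)
import Data.List.Relation.Unary.All.Properties as All
open import Data.List.Relation.Unary.Any as Any using (here; there)
open import Data.List.Relation.Unary.Any.Properties using (lookup-index)
open import Data.Nat using (ℕ; zero; suc)
open import Data.Product using (∃; _×_; _,_)
open import Data.Vec as Vec using (Vec; []; _∷_)
open import Data.Vec.Properties using (map-cong; map-∘; lookup∘tabulate)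
open import Function using (_∘_; id)
open import Function.Bundles using (_⇔_; mk⇔; Equivalence)
open import Function.Construct.Composition using (_⇔-∘_)
open import Function.Construct.Symmetry using (⇔-sym)
open import Relation.Binary.PropositionalEquality using (_≡_; _≗_; refl; sym; trans; cong; subst)
open import Relation.Nullary using (Dec; yes; no)
open import Relation.Nullary.Decidable using (map′)
open import Relation.Unary using (Decidable)

open Equivalence using (to; from)

module _ {A : Set} where

  vecs : List A → (k : ℕ) → List (Vec A k)
  vecs xs zero    = [ [] ]
  vecs xs (suc k) = cartesianProductWith _∷_ xs (vecs xs k)

  ∈-vecs : {xs : List A} → (∀ x → x ∈ xs) → ∀ {k} (ys : Vec A k) → ys ∈ vecs xs k
  ∈-vecs ∈xs []       = here refl
  ∈-vecs ∈xs (y ∷ ys) = ∈-cartesianProductWith⁺ _∷_ (∈xs y) (∈-vecs ∈xs ys)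

  any∈? : {P : A → Set} → Decidable P → (xs : List A) → Dec (∃ λ x → x ∈ xs × P x)
  any∈? P? xs = map′ find (λ (_ , x∈xs , px) → lose x∈xs px) (Any.any? P? xs)

  ∃? : {P : A → Set} (xs : List A) → (∀ x → x ∈ xs) → Decidable P → Dec (∃ P)
  ∃? xs ∈xs P? = map′ (λ (x , _ , px) → x , px) (λ (x , px) → x , ∈xs x , px) (any∈? P? xs)

bools : List Bool
bools = true ∷ false ∷ []

∈-bools : (b : Bool) → b ∈ bools
∈-bools true  = here refl
∈-bools false = there (here refl)

T-injective : ∀ {x y} → (T x ⇔ T y) → x ≡ y
T-injective {false} {false} _   = refl
T-injective {false} {true}  x⇔y = ⊥-elim (from x⇔y _)
T-injective {true}  {false} x⇔y = ⊥-elim (to x⇔y _)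
T-injective {true}  {true}  _   = refl

first : ∀ {n} → (Fin (suc n) → Bool) → Fin (suc n)
first {zero}  f = zero
first {suc n} f = if f zero then zero else suc (first (f ∘ suc))

first-true : ∀ {n} (f : Fin (suc n) → Bool) {k} → T (f k) → T (f (first f))
first-true {zero}  f {zero} fk = fk
first-true {suc n} f {k}    fk with f zero in f0
first-true {suc n} f {k}     fk | true  = subst T (sym f0) _
first-true {suc n} f {zero}  fk | false = ⊥-elim (subst T f0 fk)
first-true {suc n} f {suc k} fk | false = first-true (f ∘ suc) fk

first-cong : ∀ {n} {f g : Fin (suc n) → Bool} → f ≗ g → first f ≡ first g
first-cong {zero}  _ = refl
first-cong {suc n} {f} {g} f≗g rewrite f≗g zero with g zero
... | true  = refl
... | false = cong suc (first-cong (f≗g ∘ suc))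

module _ {τ : Signature} where
  open Signature τ

  renameAtom : ∀ {k m} → (Fin k → Fin m) → Atom τ k → Atom τ m
  renameAtom g (relA R xs) = relA R (Vec.map g xs)
  renameAtom g (eqA i j)   = eqA (g i) (g j)
  renameAtom g botA        = botA

  module _ (M : Structure τ) where
    open Structure M using (Carrier)

    SatAtom-resp : ∀ {k} {ρ ρ′ : Fin k → Carrier} → ρ ≗ ρ′ →
      ∀ {a} → SatAtom τ M ρ a → SatAtom τ M ρ′ a
    SatAtom-resp ρ≗ρ′ {relA R xs} s   = subst (Structure.rel M R) (map-cong ρ≗ρ′ xs) s
    SatAtom-resp ρ≗ρ′ {eqA i j}   ρi≡ρj = trans (sym (ρ≗ρ′ i)) (trans ρi≡ρj (ρ≗ρ′ j))
    SatAtom-resp ρ≗ρ′ {botA}      ()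

    SatAtom-rename : ∀ {k m} (ρ : Fin m → Carrier) (g : Fin k → Fin m) (a : Atom τ k) →
      SatAtom τ M ρ (renameAtom g a) ≡ SatAtom τ M (ρ ∘ g) a
    SatAtom-rename ρ g (relA R xs) = cong (Structure.rel M R) (sym (map-∘ ρ g xs))
    SatAtom-rename ρ g (eqA i j)   = refl
    SatAtom-rename ρ g botA        = refl

    All-rename : ∀ {k m} (ρ : Fin m → Carrier) (g : Fin k → Fin m) (φ : Conj τ k) →
      All (SatAtom τ M ρ) (map (renameAtom g) φ) ⇔ All (SatAtom τ M (ρ ∘ g)) φ
    All-rename ρ g φ = mk⇔
      (All.map (λ {a} → subst id (SatAtom-rename ρ g a)) ∘ All.map⁻)
      (All.map⁺ ∘ All.map (λ {a} → subst id (sym (SatAtom-rename ρ g a))))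

  SatAtom? : (B : FinStructure τ) {k : ℕ} (ρ : Fin k → Fin (suc (FinStructure.size B))) →
    Decidable (SatAtom τ (toStructure τ B) ρ)
  SatAtom? B ρ (relA R xs) = T? _
  SatAtom? B ρ (eqA i j)   = ρ i ≟ ρ j
  SatAtom? B ρ botA        = no λ ()

  -- Assignments into a finite structure are searched as vectors, since
  -- functions out of Fin n cannot be enumerated up to _≡_.
  satisfiableIn? : (B : FinStructure τ) {n : ℕ} (φ : Conj τ n) →
    Dec (SatisfiableIn τ (toStructure τ B) φ)
  satisfiableIn? B {n} φ = map′
    (λ (xs , s) → Vec.lookup xs , s)
    (λ (ρ , s) → Vec.tabulate ρ , All.map (λ {a} → SatAtom-resp (toStructure τ B) (λ i → sym (lookup∘tabulate ρ i)) {a}) s)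
    (∃? (vecs (allFin _) n) (∈-vecs ∈-allFin) (λ xs → All.all? (SatAtom? B (Vec.lookup xs)) φ))

  relAtoms : (m : ℕ) (R : Fin nRel) → List (Atom τ m)
  relAtoms m R = map (relA R) (vecs (allFin m) (arity R))

  eqAtoms : (m : ℕ) → List (Atom τ m)
  eqAtoms m = cartesianProductWith eqA (allFin m) (allFin m)

  atoms : (m : ℕ) → List (Atom τ m)
  atoms m = concatMap (relAtoms m) (allFin nRel) ++ eqAtoms m ++ [ botA ]

  ∈-atoms : ∀ {m} (a : Atom τ m) → a ∈ atoms m
  ∈-atoms {m} (relA R xs) = ∈-++⁺ˡ (∈-concatMap⁺ (relAtoms m)
    (lose (∈-allFin R) (∈-map⁺ (relA R) (∈-vecs ∈-allFin xs))))
  ∈-atoms {m} (eqA i j) = ∈-++⁺ʳ (concatMap (relAtoms m) (allFin nRel))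
    (∈-++⁺ˡ (∈-cartesianProductWith⁺ eqA (∈-allFin i) (∈-allFin j)))
  ∈-atoms {m} botA = ∈-++⁺ʳ (concatMap (relAtoms m) (allFin nRel)) (∈-++⁺ʳ (eqAtoms m) (here refl))

  -- A set of atoms over m variables is encoded as a truth table indexed by atoms m.
  holds : ∀ {m} → Vec Bool (length (atoms m)) → Atom τ m → Bool
  holds v a = Vec.lookup v (Any.index (∈-atoms a))

  diagram : ∀ {m} → (Atom τ m → Bool) → Conj τ m
  diagram t = filter (T? ∘ t) (atoms _)

  All-diagram : ∀ {m} {P : Atom τ m → Set} (t : Atom τ m → Bool) →
    All P (diagram t) ⇔ (∀ a → T (t a) → P a)
  All-diagram t = mk⇔
    (λ ps a ta → All.lookup ps (∈-filter⁺ (T? ∘ t) (∈-atoms a) ta))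
    (λ t⇒P → All.map (λ {a} → t⇒P a) (All.all-filter (T? ∘ t) (atoms _)))

  IsTypeOf : ∀ {m} → (Atom τ m → Bool) → (M : Structure τ) → (Fin m → Structure.Carrier M) → Set
  IsTypeOf t M ρ = ∀ a → T (t a) ⇔ SatAtom τ M ρ a

  structureOf : ∀ {n} → (Atom τ (suc n) → Bool) → FinStructure τ
  structureOf {n} t = record { size = n ; frel = λ R xs → t (relA R xs) }

  representative : ∀ {n} → (Atom τ (suc n) → Bool) → Fin (suc n) → Fin (suc n)
  representative t i = first (λ k → t (eqA i k))

  structureOf-sound : ∀ {n k} {t : Atom τ (suc n) → Bool} (M : Structure τ) (ρ : Fin (suc n) → Structure.Carrier M) →
    (∀ a → T (t a) → SatAtom τ M ρ a) → (ρ′ : Fin k → Fin (suc n)) →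
    ∀ {a} → SatAtom τ (toStructure τ (structureOf t)) ρ′ a → SatAtom τ M (ρ ∘ ρ′) a
  structureOf-sound M ρ t⇒M ρ′ {relA R xs} s = subst id (SatAtom-rename M ρ ρ′ (relA R xs)) (t⇒M _ s)
  structureOf-sound M ρ t⇒M ρ′ {eqA i j}   s = cong ρ s
  structureOf-sound M ρ t⇒M ρ′ {botA}      ()

  module _ {n} {t : Atom τ (suc n) → Bool} {M : Structure τ} {ρ : Fin (suc n) → Structure.Carrier M}
           (type : IsTypeOf t M ρ) where

    representative-sound : ∀ i → ρ (representative t i) ≡ ρ i
    representative-sound i =
      sym (to (type (eqA i (representative t i))) (first-true (λ k → t (eqA i k)) (from (type (eqA i i)) refl)))

    representative-cong : ∀ {i j} → ρ i ≡ ρ j → representative t i ≡ representative t j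
    representative-cong {i} {j} ρi≡ρj = first-cong λ k →
      T-injective (⇔-sym (type (eqA j k)) ⇔-∘ (mk⇔ (trans (sym ρi≡ρj)) (trans ρi≡ρj) ⇔-∘ type (eqA i k)))

    structureOf-complete : ∀ {k} (g : Fin k → Fin (suc n)) →
      ∀ {a} → SatAtom τ M (ρ ∘ g) a → SatAtom τ (toStructure τ (structureOf t)) (representative t ∘ g) a
    structureOf-complete g {relA R xs} s = from (type _)
      (subst id (sym (SatAtom-rename M ρ (representative t ∘ g) (relA R xs)))
        (SatAtom-resp M (sym ∘ representative-sound ∘ g) s))
    structureOf-complete g {eqA i j} s = representative-cong s
    structureOf-complete g {botA}    ()

  module _ {Th : Theory τ} (dec : CSPDecidable τ Th) where

    saturate : ∀ {m} → Conj τ m → (as : List (Atom τ m)) → Vec Bool (length as)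
    saturate acc []       = []
    saturate acc (a ∷ as) with dec _ (a ∷ acc)
    ... | yes _ = true  ∷ saturate (a ∷ acc) as
    ... | no _  = false ∷ saturate acc as

    record Saturation {m} (acc : Conj τ m) (as : List (Atom τ m)) (v : Vec Bool (length as)) : Set₁ where
      field
        model      : Structure τ
        isModel    : IsModel τ Th model
        assignment : Fin m → Structure.Carrier model
        satisfies  : All (SatAtom τ model assignment) acc
        decides    : ∀ k → T (Vec.lookup v k) ⇔ SatAtom τ model assignment (lookup as k)

    saturate-sound : ∀ {m} (acc : Conj τ m) (as : List (Atom τ m)) →
      SatisfiableInTheory τ Th acc → Saturation acc as (saturate acc as)
    saturate-sound acc [] (M , isM , ρ , s) = record
      { model = M ; isModel = isM ; assignment = ρ ; satisfies = s ; decides = λ () }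
    saturate-sound acc (a ∷ as) sat with dec _ (a ∷ acc)
    ... | yes sat′ = record
      { model = model ; isModel = isModel ; assignment = assignment
      ; satisfies = All.tail satisfies
      ; decides = λ { zero → mk⇔ (λ _ → All.head satisfies) _ ; (suc k) → decides k }
      }
      where open Saturation (saturate-sound (a ∷ acc) as sat′)
    ... | no unsat = record
      { model = model ; isModel = isModel ; assignment = assignment
      ; satisfies = satisfies
      ; decides = λ { zero → mk⇔ (λ ()) (λ sa → unsat (model , isModel , assignment , sa ∷ satisfies))
                    ; (suc k) → decides k }
      }
      where open Saturation (saturate-sound acc as sat)

    sample : ℕ → List (FinStructure τ)
    sample n = map (structureOf ∘ holds) (filter (λ v → dec (suc n) (diagram (holds v))) (vecs bools _))

    sample-sound : ∀ n (φ : Conj τ n) →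
      (∃ λ B → B ∈ sample n × SatisfiableIn τ (toStructure τ B) φ) → SatisfiableInTheory τ Th φ
    sample-sound n φ (B , B∈ , ρ′ , s) with ∈-map⁻ (structureOf ∘ holds) B∈
    ... | v , v∈ , refl with ∈-filter⁻ (λ v → dec (suc n) (diagram (holds v))) {xs = vecs bools _} v∈
    ... | _ , (M , isM , ρ , d) =
      M , isM , ρ ∘ ρ′ , All.map (λ {a} → structureOf-sound M ρ (to (All-diagram (holds v)) d) ρ′ {a}) s

    sample-complete : ∀ n (φ : Conj τ n) →
      SatisfiableInTheory τ Th φ → ∃ λ B → B ∈ sample n × SatisfiableIn τ (toStructure τ B) φ
    sample-complete n φ (M , isM , σ , s) =
      structureOf t , structureOf-t∈sample , representative t ∘ suc ,
      All.map (λ {a} → structureOf-complete type suc {a}) (to (All-rename model assignment suc φ) satisfies)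
      where
        φ↑ : Conj τ (suc n)
        φ↑ = map (renameAtom suc) φ

        φ↑-sat : SatisfiableInTheory τ Th φ↑
        φ↑-sat = M , isM , extend τ (Structure.point M) σ , from (All-rename M _ suc φ) s

        open Saturation (saturate-sound φ↑ (atoms (suc n)) φ↑-sat)

        v : Vec Bool (length (atoms (suc n)))
        v = saturate φ↑ (atoms (suc n))

        t : Atom τ (suc n) → Bool
        t = holds v

        type : IsTypeOf t model assignment
        type a = mk⇔
          (subst (SatAtom τ model assignment) (sym a≡) ∘ to (decides _))
          (from (decides _) ∘ subst (SatAtom τ model assignment) a≡)
          where a≡ = lookup-index (∈-atoms a)

        structureOf-t∈sample : structureOf t ∈ sample n
        structureOf-t∈sample = ∈-map⁺ (structureOf ∘ holds) (∈-filter⁺ (λ v → dec (suc n) (diagram (holds v)))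
          (∈-vecs ∈-bools v) (model , isModel , assignment , from (All-diagram t) (λ a → to (type a))))

sampling⇒cspDecidable : ∀ {τ} {Th : Theory τ} → HasComputableSampling τ Th → CSPDecidable τ Th
sampling⇒cspDecidable (L , isSampling) n φ =
  map′ (from (isSampling n φ)) (to (isSampling n φ)) (any∈? (λ B → satisfiableIn? B φ) (L n))

cspDecidable⇒sampling : ∀ {τ} {Th : Theory τ} → CSPDecidable τ Th → HasComputableSampling τ Th
cspDecidable⇒sampling dec = sample dec , λ n φ → mk⇔ (sample-complete dec n φ) (sample-sound dec n φ)

proposition2p8 : (τ : Signature) (Th : Theory τ) →
    HasComputableSampling τ Th ⇔ CSPDecidable τ Th
proposition2p8 τ Th = mk⇔ sampling⇒cspDecidable cspDecidable⇒sampling
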